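{- Given correct adaptive weight predictions, there exists a non-clairvoyant $4$-competitive algorithm for minimizing the total weighted completion time of jobs with online out-forest precedence constraints on a single machine.
   Context: Problem (non-clairvoyant single-machine scheduling with online precedence constraints): jobs $J$ with processing requirements $p_j\ge0$ and weights $w_j\ge0$; precedence DAG $G=(J,E)$ which is an out-forest (every job has at most one incoming edge). A job can only be processed after all its predecessors are completed, and is revealed to the algorithm (with its weight but not its processing requirement) only then; the algorithm does not know $G$. Time is discrete; rates $R_j^t\ge0$ with $\sum_jR_j^t\le1$; $C_j$ is the first $t$ with $\sum_{t'\le t}R_j^{t'}\ge p_j$. Objective: minimize $\sum_jw_jC_j$ against the offline optimum; $\rho$-competitive means $\mathrm{Alg}\le\rho\,\mathrm{Opt}$ always. For a job $v$, $S(v)$ is $v$ together with all its successors and $w(S(v))=\sum_{u\in S(v)}w_u$. Adaptive weight predictions: whenever a job $v$ becomes visible, the algorithm receives a prediction $\hat W_v$ of $w(S(v))$; correct means $\hat W_v=w(S(v))$.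
   Formalization: Processing requirements, weights, predictions and processing rates are taken to be rational numbers rather than real numbers, for the algorithm and for the offline schedules it is compared with. -}

module Defs where

open import Data.Nat using (ℕ; zero; suc; _<_)
open import Data.Fin using (Fin; toℕ)
open import Data.Fin.Base using ()
open import Data.Maybe using (Maybe; just; nothing)
open import Data.Bool using (Bool; true; false; _∧_; _∨_; if_then_else_; not)
open import Data.List using (List; []; _∷_; foldr; map; filter; allFin)
open import Data.Product using (Σ; _×_; _,_; proj₁; proj₂; ∃)
open import Data.Integer using (+_)
open import Data.Rational using (ℚ; 0ℚ; 1ℚ; _+_; _*_; _≤_; _<_; _≤ᵇ_; _/_)
open import Data.Fin.Properties using (_≟_)
open import Relation.Nullary using (does)
open import Relation.Binary.PropositionalEquality using (_≡_)

Σℚ : {n : ℕ} → (Fin n → ℚ) → ℚ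
Σℚ {n} f = foldr (λ j acc → f j + acc) 0ℚ (allFin n)

ℕ→ℚ : ℕ → ℚ
ℕ→ℚ m = + m / 1

-- Instances: n jobs, processing requirements, weights, an out-forest
-- given by a parent function (at most one incoming edge per job),
-- acyclicity witnessed by a rank function.

record Instance : Set where
  field
    n       : ℕ
    p       : Fin n → ℚ            -- processing requirements (hidden from the algorithm)
    w       : Fin n → ℚ
    parent  : Fin n → Maybe (Fin n)
    p≥0     : ∀ j → 0ℚ ≤ p j
    w≥0     : ∀ j → 0ℚ ≤ w j
    acyclic : Σ (Fin n → ℕ) λ rank →
                ∀ i j → parent j ≡ just i → rank i Data.Nat.< rank j

module _ (I : Instance) where
  open Instance I

  -- u ∈ S(v): v lies on the parent-chain of u (u itself included).
  -- Fuel n suffices since chains in an acyclic forest have ≤ n nodes.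
  inSuccF : ℕ → Fin n → Fin n → Bool
  inSuccF zero    u v = false
  inSuccF (suc f) u v with does (u ≟ v)
  ... | true  = true
  ... | false with parent u
  ...   | nothing = false
  ...   | just i  = inSuccF f i v

  wS : Fin n → ℚ
  wS v = Σℚ (λ u → if inSuccF n u v then w u else 0ℚ)

  -- Rate functions: R t j is the rate of job j in time step t+1.
  -- Amount processed after the first t steps.
  proc : (ℕ → Fin n → ℚ) → ℕ → Fin n → ℚ
  proc R zero    j = 0ℚ
  proc R (suc t) j = proc R t j + R t j

  doneF : ℕ → (Fin n → ℚ) → Fin n → Bool
  doneF zero    q j = false
  doneF (suc f) q j with p j ≤ᵇ q j
  ... | false = false
  ... | true with parent j
  ...   | nothing = true
  ...   | just i  = doneF f q i

  doneQ : (Fin n → ℚ) → Fin n → Bool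
  doneQ = doneF n

  revealedQ : (Fin n → ℚ) → Fin n → Bool
  revealedQ q j with parent j
  ... | nothing = true
  ... | just i  = doneQ q i

  done : (ℕ → Fin n → ℚ) → ℕ → Fin n → Bool
  done R t = doneQ (proc R t)

  revealed : (ℕ → Fin n → ℚ) → ℕ → Fin n → Bool
  revealed R t = revealedQ (proc R t)

  Feasible : (ℕ → Fin n → ℚ) → Set
  Feasible R = (∀ t j → 0ℚ ≤ R t j)
             × (∀ t → Σℚ (R t) ≤ 1ℚ)
             × (∀ t j → 0ℚ Data.Rational.< R t j → revealed R t j ≡ true)

  IsCompletion : (ℕ → Fin n → ℚ) → (Fin n → ℕ) → Set
  IsCompletion R C = ∀ j → done R (C j) j ≡ true
                         × (∀ t → t Data.Nat.< C j → done R t j ≡ false)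

  cost : (Fin n → ℕ) → ℚ
  cost C = Σℚ (λ j → w j * ℕ→ℚ (C j))

-- What the online non-clairvoyant algorithm observes about a revealed job.

record JobView : Set where
  constructor jobView
  field
    jid        : ℕ
    weight     : ℚ
    prediction : ℚ     -- predicted W-hat_v of w(S(v))
    completed  : Bool

-- An online algorithm: given the history of observations (list of
-- snapshots, most recent first; each snapshot lists the revealed jobs),
-- output the rates (indexed by job identifier) for the next step.
Algorithm : Set
Algorithm = List (List JobView) → ℕ → ℚ

module _ (I : Instance) (pred : Fin (Instance.n I) → ℚ) (A : Algorithm) where
  open Instance I

  snapshot : (Fin n → ℚ) → List JobView
  snapshot q = map (λ j → jobView (toℕ j) (w j) (pred j) (doneQ I q j))
                   (filter (λ j → Data.Bool._≟_ (revealedQ I q j) true) (allFin n))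

  sim : ℕ → (Fin n → ℚ) × List (List JobView)
  sim zero    = (λ _ → 0ℚ) , (snapshot (λ _ → 0ℚ) ∷ [])
  sim (suc t) with sim t
  ... | q , h = q' , (snapshot q' ∷ h)
    where q' : Fin n → ℚ
          q' j = q j + A h (toℕ j)

  algRates : ℕ → Fin n → ℚ
  algRates t j = A (proj₂ (sim t)) (toℕ j)

{-# OPTIONS --safe #-}

-- Let ω v = w(S(v)) and let W(s) be the unfinished weight after s steps; every unfinished job
-- has exactly one ancestor in the front, so W(s) is the sum of ω over the front.  The algorithm
-- runs each front job v at rate ω v / W(s), and its cost is Σ_s W(s).
--
-- Call a step of a front job v last if v completes in it and full otherwise, and split
-- W = F + L accordingly; then W ≤ F² / W + 2 L.
--
-- Every job of positive length has one last step, so Σ_s L(s) is at most Σ_j w_j d_j, where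
-- d_j counts the ancestors of j of positive length.  Any schedule needs a separate step for
-- each of them, so Σ_s L(s) ≤ Opt.
--
-- In full steps v receives at most p_v, so along the chain of i the values 1 / W(s) add up to
-- at most V_i = Σ_v p_v / ω v, over the ancestors v of i.  Hence Σ_s F² / W is at most
-- Σ_{i,j} w_i w_j min(V_i, V_j).  In a schedule with completion times C′ let H_i(t) be V_i with
-- p_v replaced by the amount of v processed by time t.  Then Σ_i w_i H_i(t) ≤ t, and
-- min(V_i, V_j) ≤ H_i(C′_j) + H_j(C′_i), because the job that completes first has been
-- processed by the time the other one completes.  So Σ_s F² / W ≤ 2 Opt, and the cost is at
-- most 4 Opt.
module Submission where

open import Defs
open import Data.Nat using (ℕ; zero; suc)
import Data.Nat as ℕ
import Data.Nat.Properties as ℕₚ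
open import Data.Fin using (Fin; toℕ)
open import Data.Fin.Properties using (_≟_; pigeonhole)
import Data.Bool as Bool
open import Data.Bool using (Bool; true; false; _∧_; _∨_; not; if_then_else_; T)
open import Data.Bool.Properties using (∧-zeroʳ; ∧-conicalˡ; ∧-conicalʳ; not-injective)
open import Data.Integer using (+_)
import Data.Integer as ℤ
import Data.Integer.Properties as ℤₚ
open import Data.List using (List; []; _∷_; foldr; map; filter; allFin; tabulate; downFrom)
open import Data.Maybe using (just; nothing; maybe)
open import Data.Product using (Σ; _×_; _,_; proj₁; proj₂)
open import Data.Rational using (ℚ; 0ℚ; 1ℚ; _+_; _≤_; _<_; _≤ᵇ_; _*_; 1/_; toℚᵘ; mkℚ; ≢-nonZero; nonNegative)
open import Data.Rational.Properties
  using (≤-refl; ≤-reflexive; ≤-trans; ≤-antisym; <⇒≤; ≰⇒>; <-irrefl; <-≤-trans;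
         +-mono-≤; +-monoʳ-≤; +-monoˡ-≤; +-comm; +-identityˡ; +-identityʳ;
         *-comm; *-assoc; *-identityˡ; *-identityʳ; *-zeroˡ; *-zeroʳ; *-distribˡ-+; *-inverseʳ;
         ≤ᵇ⇒≤; ≤⇒≤ᵇ; nonNegative⁻¹; nonNeg*nonNeg⇒nonNeg; *-monoˡ-≤-nonNeg; *-monoʳ-≤-nonNeg;
         pos⇒nonNeg; nonNeg∧nonZero⇒pos; 1/pos⇒pos; toℚᵘ-injective; toℚᵘ-fromℚᵘ; toℚᵘ-homo-+; toℚᵘ-cancel-<;
         module ≤-Reasoning)
import Data.Rational.Properties as ℚₚ
open import Data.Rational.Solver using (module +-*-Solver)
open +-*-Solver using (solve; con; _:=_; _:+_; _:*_)
import Data.Rational.Unnormalised as ℚᵘ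
import Data.Rational.Unnormalised.Properties as ℚᵘₚ
open import Data.Sum using (_⊎_; inj₁; inj₂)
open import Data.Empty using (⊥-elim)
open import Data.Unit using (tt)
open import Function using (_∘_; id)
open import Relation.Nullary using (Dec; yes; no; does)
open import Relation.Binary.PropositionalEquality
  using (_≡_; _≢_; refl; sym; trans; cong; cong₂; subst; subst₂; module ≡-Reasoning)

private
  variable
    X Y : Set
    a b c : ℚ

false≢true : false ≢ true
false≢true ()

-- Rational arithmetic

*-nonneg : 0ℚ ≤ a → 0ℚ ≤ b → 0ℚ ≤ a * b
*-nonneg {a} {b} 0≤a 0≤b =
  nonNegative⁻¹ (a * b) {{nonNeg*nonNeg⇒nonNeg a {{nonNegative 0≤a}} b {{nonNegative 0≤b}}}}

+-nonneg : 0ℚ ≤ a → 0ℚ ≤ b → 0ℚ ≤ a + b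
+-nonneg = +-mono-≤

*-monoˡ : 0ℚ ≤ c → a ≤ b → c * a ≤ c * b
*-monoˡ {c} 0≤c = *-monoˡ-≤-nonNeg c {{nonNegative 0≤c}}

*-monoʳ : 0ℚ ≤ c → a ≤ b → a * c ≤ b * c
*-monoʳ {c} 0≤c = *-monoʳ-≤-nonNeg c {{nonNegative 0≤c}}

a≤a+b : 0ℚ ≤ b → a ≤ a + b
a≤a+b {b} {a} 0≤b = subst (_≤ a + b) (+-identityʳ a) (+-monoʳ-≤ a 0≤b)

b≤a+b : 0ℚ ≤ a → b ≤ a + b
b≤a+b {a} {b} 0≤a = subst (_≤ a + b) (+-identityˡ b) (+-monoˡ-≤ b 0≤a)

0≤1 : 0ℚ ≤ 1ℚ
0≤1 = nonNegative⁻¹ 1ℚ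

0<1 : 0ℚ < 1ℚ
0<1 = ℚₚ.positive⁻¹ 1ℚ

≤ᵇ-true⇒≤ : (a ≤ᵇ b) ≡ true → a ≤ b
≤ᵇ-true⇒≤ eq = ≤ᵇ⇒≤ (subst T (sym eq) tt)

≤⇒≤ᵇ-true : a ≤ b → (a ≤ᵇ b) ≡ true
≤⇒≤ᵇ-true {a} {b} a≤b with a ≤ᵇ b | ≤⇒≤ᵇ a≤b
... | true | _ = refl

≤ᵇ-false⇒> : (a ≤ᵇ b) ≡ false → b < a
≤ᵇ-false⇒> eq = ≰⇒> λ a≤b → false≢true (trans (sym eq) (≤⇒≤ᵇ-true a≤b))

-- inv 0ℚ = 0ℚ
inv : ℚ → ℚ
inv a with a ℚₚ.≟ 0ℚ
... | yes _  = 0ℚ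
... | no a≢0 = (1/ a) {{≢-nonZero a≢0}}

inv-inverse : a ≢ 0ℚ → a * inv a ≡ 1ℚ
inv-inverse {a} a≢0 with a ℚₚ.≟ 0ℚ
... | yes a≡0 = ⊥-elim (a≢0 a≡0)
... | no a≢0′ = *-inverseʳ a {{≢-nonZero a≢0′}}

inv-nonneg : 0ℚ ≤ a → 0ℚ ≤ inv a
inv-nonneg {a} 0≤a with a ℚₚ.≟ 0ℚ
... | yes _  = ≤-refl
... | no a≢0 = nonNegative⁻¹ a⁻¹ {{pos⇒nonNeg a⁻¹ {{1/pos⇒pos a {{apos}}}}}}
  where
  a⁻¹  = (1/ a) {{≢-nonZero a≢0}}
  apos = nonNeg∧nonZero⇒pos a {{nonNegative 0≤a}} {{≢-nonZero a≢0}}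

*-inv≤1 : ∀ a → a * inv a ≤ 1ℚ
*-inv≤1 a with a ℚₚ.≟ 0ℚ
... | yes _  = ≤-trans (≤-reflexive (*-zeroʳ a)) 0≤1
... | no a≢0 = ≤-reflexive (*-inverseʳ a {{≢-nonZero a≢0}})

toℚᵘ-ℕ→ℚ : ∀ m → toℚᵘ (ℕ→ℚ m) ℚᵘ.≃ ℚᵘ.mkℚᵘ (+ m) 0
toℚᵘ-ℕ→ℚ m = toℚᵘ-fromℚᵘ (ℚᵘ.mkℚᵘ (+ m) 0)

ℕ→ℚ-suc : ∀ m → ℕ→ℚ (suc m) ≡ 1ℚ + ℕ→ℚ m
ℕ→ℚ-suc m = toℚᵘ-injective (begin
  toℚᵘ (ℕ→ℚ (suc m))                     ≈⟨ toℚᵘ-ℕ→ℚ (suc m) ⟩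
  ℚᵘ.mkℚᵘ (+ suc m) 0                    ≈⟨ ℚᵘ.*≡* eq ⟩
  ℚᵘ.1ℚᵘ ℚᵘ.+ ℚᵘ.mkℚᵘ (+ m) 0            ≈⟨ ℚᵘₚ.+-congʳ ℚᵘ.1ℚᵘ (ℚᵘₚ.≃-sym (toℚᵘ-ℕ→ℚ m)) ⟩
  ℚᵘ.1ℚᵘ ℚᵘ.+ toℚᵘ (ℕ→ℚ m)               ≈⟨ ℚᵘₚ.≃-sym (toℚᵘ-homo-+ 1ℚ (ℕ→ℚ m)) ⟩
  toℚᵘ (1ℚ + ℕ→ℚ m)                      ∎)
  where
  open import Relation.Binary.Reasoning.Setoid ℚᵘₚ.≃-setoid
  eq : + suc m ℤ.* + 1 ≡ (+ 1 ℤ.* + 1 ℤ.+ + m ℤ.* + 1) ℤ.* + 1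
  eq = cong (λ k → (+ 1 ℤ.+ k) ℤ.* + 1) (sym (ℤₚ.*-identityʳ (+ m)))

ℕ→ℚ-nonneg : ∀ m → 0ℚ ≤ ℕ→ℚ m
ℕ→ℚ-nonneg zero    = ≤-refl
ℕ→ℚ-nonneg (suc m) = subst (0ℚ ≤_) (sym (ℕ→ℚ-suc m)) (+-nonneg 0≤1 (ℕ→ℚ-nonneg m))

ℕ→ℚ-mono : ∀ {k m} → k ℕ.≤ m → ℕ→ℚ k ≤ ℕ→ℚ m
ℕ→ℚ-mono {m = m}     ℕ.z≤n       = ℕ→ℚ-nonneg m
ℕ→ℚ-mono {suc k} {suc m} (ℕ.s≤s k≤m) =
  subst (_≤ ℕ→ℚ (suc m)) (sym (ℕ→ℚ-suc k))
    (subst (1ℚ + ℕ→ℚ k ≤_) (sym (ℕ→ℚ-suc m)) (+-monoʳ-≤ 1ℚ (ℕ→ℚ-mono k≤m)))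

archimedean : ∀ a → Σ ℕ λ m → a < ℕ→ℚ m
archimedean a@(mkℚ k d-1 _) = suc ℤ.∣ k ∣ , toℚᵘ-cancel-< (ℚᵘₚ.<-respʳ-≃ (ℚᵘₚ.≃-sym (toℚᵘ-ℕ→ℚ (suc ℤ.∣ k ∣))) (ℚᵘ.*<* lt))
  where
  lt : k ℤ.* + 1 ℤ.< + suc ℤ.∣ k ∣ ℤ.* + suc d-1
  lt = subst (λ i → i ℤ.< + suc ℤ.∣ k ∣ ℤ.* + suc d-1) (sym (ℤₚ.*-identityʳ k))
         (ℤₚ.≤-<-trans (k≤∣k∣ k)
           (ℤ.+<+ (ℕₚ.m≤m*n (suc ℤ.∣ k ∣) (suc d-1))))
    where
    k≤∣k∣ : ∀ k → k ℤ.≤ + ℤ.∣ k ∣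
    k≤∣k∣ (+ _)      = ℤₚ.≤-refl
    k≤∣k∣ ℤ.-[1+ _ ] = ℤ.-≤+

-- Finite sums

∑ : List X → (X → ℚ) → ℚ
∑ []       f = 0ℚ
∑ (x ∷ xs) f = f x + ∑ xs f

foldr≡∑ : ∀ (xs : List X) (f : X → ℚ) → foldr (λ x acc → f x + acc) 0ℚ xs ≡ ∑ xs f
foldr≡∑ []       f = refl
foldr≡∑ (x ∷ xs) f = cong (_+_ (f x)) (foldr≡∑ xs f)

∑-cong : ∀ (xs : List X) {f g : X → ℚ} → (∀ x → f x ≡ g x) → ∑ xs f ≡ ∑ xs g
∑-cong []       eq = refl
∑-cong (x ∷ xs) eq = cong₂ _+_ (eq x) (∑-cong xs eq)

∑-mono : ∀ (xs : List X) {f g : X → ℚ} → (∀ x → f x ≤ g x) → ∑ xs f ≤ ∑ xs g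
∑-mono []       le = ≤-refl
∑-mono (x ∷ xs) le = +-mono-≤ (le x) (∑-mono xs le)

∑-zero : ∀ (xs : List X) → ∑ xs (λ _ → 0ℚ) ≡ 0ℚ
∑-zero []       = refl
∑-zero (x ∷ xs) = trans (+-identityˡ _) (∑-zero xs)

∑-nonneg : ∀ (xs : List X) {f : X → ℚ} → (∀ x → 0ℚ ≤ f x) → 0ℚ ≤ ∑ xs f
∑-nonneg xs 0≤f = subst (_≤ ∑ xs _) (∑-zero xs) (∑-mono xs 0≤f)

∑-+ : ∀ (xs : List X) (f g : X → ℚ) → ∑ xs (λ x → f x + g x) ≡ ∑ xs f + ∑ xs g
∑-+ []       f g = refl
∑-+ (x ∷ xs) f g = trans (cong (_+_ (f x + g x)) (∑-+ xs f g))
  (solve 4 (λ a b c d → (a :+ b) :+ (c :+ d) := (a :+ c) :+ (b :+ d)) refl (f x) (g x) (∑ xs f) (∑ xs g))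

∑-*ˡ : ∀ (xs : List X) (c : ℚ) (f : X → ℚ) → c * ∑ xs f ≡ ∑ xs (λ x → c * f x)
∑-*ˡ []       c f = *-zeroʳ c
∑-*ˡ (x ∷ xs) c f = trans (*-distribˡ-+ c (f x) (∑ xs f)) (cong (_+_ (c * f x)) (∑-*ˡ xs c f))

∑-*ʳ : ∀ (xs : List X) (c : ℚ) (f : X → ℚ) → ∑ xs f * c ≡ ∑ xs (λ x → f x * c)
∑-*ʳ xs c f = trans (*-comm (∑ xs f) c) (trans (∑-*ˡ xs c f) (∑-cong xs λ x → *-comm c (f x)))

∑-swap : ∀ (xs : List X) (ys : List Y) (f : X → Y → ℚ) →
         ∑ xs (λ x → ∑ ys (f x)) ≡ ∑ ys (λ y → ∑ xs (λ x → f x y))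
∑-swap []       ys f = sym (∑-zero ys)
∑-swap (x ∷ xs) ys f = trans (cong (_+_ (∑ ys (f x))) (∑-swap xs ys f))
  (sym (∑-+ ys (f x) (λ y → ∑ xs (λ x → f x y))))

⟦_⟧ : Bool → ℚ
⟦ true  ⟧ = 1ℚ
⟦ false ⟧ = 0ℚ

⟦⟧-nonneg : ∀ b → 0ℚ ≤ ⟦ b ⟧
⟦⟧-nonneg true  = 0≤1
⟦⟧-nonneg false = ≤-refl

⟦⟧≤1 : ∀ b → ⟦ b ⟧ ≤ 1ℚ
⟦⟧≤1 true  = ≤-refl
⟦⟧≤1 false = 0≤1

⟦⟧*-nonneg : ∀ b → 0ℚ ≤ a → 0ℚ ≤ ⟦ b ⟧ * a
⟦⟧*-nonneg b = *-nonneg (⟦⟧-nonneg b)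

⟦⟧*-≤ : ∀ b → 0ℚ ≤ a → ⟦ b ⟧ * a ≤ a
⟦⟧*-≤ {a} b 0≤a = subst (⟦ b ⟧ * a ≤_) (*-identityˡ a) (*-monoʳ 0≤a (⟦⟧≤1 b))

∑-tabulate : ∀ {n} (g : Fin n → X) (h : Fin n → Y) {f : X → ℚ} {f′ : Y → ℚ} →
             (∀ i → f (g i) ≡ f′ (h i)) → ∑ (tabulate g) f ≡ ∑ (tabulate h) f′
∑-tabulate {n = zero}  g h eq = refl
∑-tabulate {n = suc n} g h eq =
  cong₂ _+_ (eq Fin.zero) (∑-tabulate (g ∘ Fin.suc) (h ∘ Fin.suc) (eq ∘ Fin.suc))

∑-δ : ∀ {n} (j : Fin n) (f : Fin n → ℚ) → ∑ (allFin n) (λ v → ⟦ does (j ≟ v) ⟧ * f v) ≡ f j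
∑-δ {suc n} Fin.zero f = trans
  (cong₂ _+_ (*-identityˡ (f Fin.zero))
    (trans (∑-tabulate Fin.suc id {f′ = λ _ → 0ℚ} (λ i → *-zeroˡ (f (Fin.suc i)))) (∑-zero (allFin n))))
  (+-identityʳ (f Fin.zero))
∑-δ {suc n} (Fin.suc j) f = trans
  (cong₂ _+_ (*-zeroˡ (f Fin.zero)) (trans (∑-tabulate {n = n} Fin.suc id (λ i → refl)) (∑-δ j (f ∘ Fin.suc))))
  (+-identityˡ (f (Fin.suc j)))

term≤∑ : ∀ {n} (j : Fin n) {f : Fin n → ℚ} → (∀ v → 0ℚ ≤ f v) → f j ≤ ∑ (allFin n) f
term≤∑ {n} j {f} 0≤f = subst (_≤ ∑ (allFin n) f) (∑-δ j f)
  (∑-mono (allFin n) λ v → ⟦⟧*-≤ (does (j ≟ v)) (0≤f v))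

-- Since `m = f + l`, the identity `f² + 2 l m = m² + l²` holds, and division by `m` leaves the
-- surplus `l² / m`. For `m = 0` it is enough that the right side is nonnegative.
split-square : ∀ {m} f l → m ≡ f + l → 0ℚ ≤ f → 0ℚ ≤ l → m ≤ f * f * inv m + (l + l)
split-square {m} f l m≡f+l 0≤f 0≤l = go (m ℚₚ.≟ 0ℚ)
  where
  y = inv m
  0≤y : 0ℚ ≤ y
  0≤y = inv-nonneg (subst (0ℚ ≤_) (sym m≡f+l) (+-nonneg 0≤f 0≤l))
  eq : m ≢ 0ℚ → f * f * y + (l + l) ≡ m + l * l * y
  eq m≢0 = begin
    f * f * y + (l + l)                          ≡⟨ cong (_+_ (f * f * y)) (sym (*-identityʳ (l + l))) ⟩
    f * f * y + (l + l) * 1ℚ                     ≡⟨ cong (λ z → f * f * y + (l + l) * z) (sym my≡1) ⟩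
    f * f * y + (l + l) * ((f + l) * y)          ≡⟨ solve 3 (λ f l y → f :* f :* y :+ (l :+ l) :* ((f :+ l) :* y)
                                                      := (f :+ l) :* ((f :+ l) :* y) :+ l :* l :* y) refl f l y ⟩
    (f + l) * ((f + l) * y) + l * l * y          ≡⟨ cong (λ z → (f + l) * z + l * l * y) my≡1 ⟩
    (f + l) * 1ℚ + l * l * y                     ≡⟨ cong (_+ l * l * y) (trans (*-identityʳ (f + l)) (sym m≡f+l)) ⟩
    m + l * l * y                                ∎
    where
    open ≡-Reasoning
    my≡1 : (f + l) * y ≡ 1ℚ
    my≡1 = trans (cong (_* y) (sym m≡f+l)) (inv-inverse m≢0)
  go : Dec (m ≡ 0ℚ) → m ≤ f * f * y + (l + l)
  go (yes m≡0) = subst (_≤ f * f * y + (l + l)) (sym m≡0)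
    (+-nonneg (*-nonneg (*-nonneg 0≤f 0≤f) 0≤y) (+-nonneg 0≤l 0≤l))
  go (no m≢0)  = subst (m ≤_) (sym (eq m≢0)) (a≤a+b (*-nonneg (*-nonneg 0≤l 0≤l) 0≤y))

-- Counting the times before a Boolean sequence turns true

falses : (ℕ → Bool) → ℕ → ℕ
falses b zero    = 0
falses b (suc t) = if b t then falses b t else suc (falses b t)

-- As a sum of indicators, a completion time can be exchanged with the sum over jobs, which regroups
-- the cost by time step.
ℕ→ℚ-falses : ∀ b t → ℕ→ℚ (falses b t) ≡ ∑ (downFrom t) (λ s → ⟦ not (b s) ⟧)
ℕ→ℚ-falses b zero    = refl
ℕ→ℚ-falses b (suc t) with b t
... | true  = trans (ℕ→ℚ-falses b t) (sym (+-identityˡ _))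
... | false = trans (ℕ→ℚ-suc (falses b t)) (cong (_+_ 1ℚ) (ℕ→ℚ-falses b t))

falses≤ : ∀ b t → falses b t ℕ.≤ t
falses≤ b zero    = ℕ.z≤n
falses≤ b (suc t) with b t
... | true  = ℕₚ.m≤n⇒m≤1+n (falses≤ b t)
... | false = ℕ.s≤s (falses≤ b t)

module _ {b : ℕ → Bool} (mono : ∀ {s t} → s ℕ.≤ t → b s ≡ true → b t ≡ true) where

  false-before : ∀ {s t} → s ℕ.≤ t → b t ≡ false → b s ≡ false
  false-before {s} s≤t bt with b s in bs
  ... | false = refl
  ... | true  = trans (sym (mono s≤t bs)) bt

  falses-all : ∀ t → b t ≡ false → falses b t ≡ t
  falses-all zero    _  = refl
  falses-all (suc t) bt with false-before (ℕₚ.n≤1+n t) bt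
  ... | bt′ rewrite bt′ = cong suc (falses-all t bt′)

  false-below-falses : ∀ t s → s ℕ.< falses b t → b s ≡ false
  false-below-falses (suc t) s s< with b t in bt
  ... | true  = false-below-falses t s s<
  ... | false = false-before (ℕₚ.≤-trans (ℕ.s≤s⁻¹ s<) (falses≤ b t)) bt

  true-at-falses : ∀ t → b t ≡ true → b (falses b t) ≡ true
  true-at-falses zero    bt = bt
  true-at-falses (suc t) bt with b t in bt′
  ... | true  = true-at-falses t bt′
  -- Here `t` is the last false time, so the count up to it is `t`, and the final count `suc t` is
  -- the first true time.
  ... | false = subst (λ k → b (suc k) ≡ true) (sym (falses-all t bt′)) bt

-- Out-forests

module Forest (I : Instance) where
  open Instance I

  J : List (Fin n)
  J = allFin n

  anc : Fin n → Fin n → Bool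
  anc = inSuccF I n

  -- Ends f j: the parent chain of j has at most f nodes, so that fuel f is enough for j.
  data Ends : ℕ → Fin n → Set where
    root : ∀ {f j} → parent j ≡ nothing → Ends (suc f) j
    step : ∀ {f j i} → parent j ≡ just i → Ends f i → Ends (suc f) j

  private
    rank = proj₁ acyclic

    Descent : ℕ → Fin n → Set
    Descent f j = Σ (Fin (suc f) → Fin n) λ s →
      s Fin.zero ≡ j × (∀ k l → toℕ k ℕ.< toℕ l → rank (s l) ℕ.< rank (s k))

    -- Climbing from `j` either meets a root within `f` nodes or visits `suc f` nodes of falling
    -- rank. The fall is recorded for all pairs, so that any collision found by the pigeonhole
    -- principle contradicts it.
    ends⊎descent : ∀ f j → Ends f j ⊎ Descent f j
    ends⊎descent zero    j = inj₂ ((λ _ → j) , refl , λ { Fin.zero Fin.zero () })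
    ends⊎descent (suc f) j with parent j in eq
    ... | nothing = inj₁ (root eq)
    ... | just i  with ends⊎descent f i
    ...   | inj₁ e                 = inj₁ (step eq e)
    ...   | inj₂ (s , s₀≡i , desc) = inj₂ (s′ , refl , desc′)
      where
      s′ : Fin (suc (suc f)) → Fin n
      s′ Fin.zero    = j
      s′ (Fin.suc k) = s k
      s₀<j : rank (s Fin.zero) ℕ.< rank j
      s₀<j = subst (λ i → rank i ℕ.< rank j) (sym s₀≡i) (proj₂ acyclic i j eq)
      desc′ : ∀ k l → toℕ k ℕ.< toℕ l → rank (s′ l) ℕ.< rank (s′ k)
      desc′ Fin.zero    (Fin.suc Fin.zero)    _ = s₀<j
      desc′ Fin.zero    (Fin.suc (Fin.suc l)) _ =
        ℕₚ.<-trans (desc Fin.zero (Fin.suc l) (ℕ.s≤s ℕ.z≤n)) s₀<j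
      desc′ (Fin.suc k) (Fin.suc l) (ℕ.s≤s k<l) = desc k l k<l

  ends : ∀ j → Ends n j
  ends j with ends⊎descent n j
  ... | inj₁ e              = e
  ... | inj₂ (s , _ , desc) with pigeonhole (ℕₚ.n<1+n n) s
  ...   | k , l , k<l , sk≡sl = ⊥-elim (ℕₚ.<-irrefl (cong rank (sym sk≡sl)) (desc k l k<l))

  inSuccF-suc : ∀ f u v →
    inSuccF I (suc f) u v ≡ does (u ≟ v) ∨ maybe (λ i → inSuccF I f i v) false (parent u)
  inSuccF-suc f u v with does (u ≟ v)
  ... | true  = refl
  ... | false with parent u
  ...   | nothing = refl
  ...   | just i  = refl

  doneF-suc : ∀ f q j → doneF I (suc f) q j ≡ (p j ≤ᵇ q j) ∧ maybe (doneF I f q) true (parent j)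
  doneF-suc f q j with p j ≤ᵇ q j
  ... | false = refl
  ... | true with parent j
  ...   | nothing = refl
  ...   | just i  = refl

  revealedQ-parent : ∀ q j → revealedQ I q j ≡ maybe (doneQ I q) true (parent j)
  revealedQ-parent q j with parent j
  ... | nothing = refl
  ... | just i  = refl

  -- Here and in `doneF-fuel`, surplus fuel is harmless once the chain has ended. This gives the
  -- recursions `anc-parent` and `doneQ-revealedQ` the same fuel `n` on both sides.
  inSuccF-fuel : ∀ {f u} → Ends f u → ∀ v → inSuccF I f u v ≡ inSuccF I (suc f) u v
  inSuccF-fuel {suc f} {u} (root eq) v
    rewrite inSuccF-suc f u v | inSuccF-suc (suc f) u v | eq = refl
  inSuccF-fuel {suc f} {u} (step {i = i} eq e) v
    rewrite inSuccF-suc f u v | inSuccF-suc (suc f) u v | eq =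
      cong (does (u ≟ v) ∨_) (inSuccF-fuel e v)

  doneF-fuel : ∀ {f j} → Ends f j → ∀ q → doneF I f q j ≡ doneF I (suc f) q j
  doneF-fuel {suc f} {j} (root eq) q
    rewrite doneF-suc f q j | doneF-suc (suc f) q j | eq = refl
  doneF-fuel {suc f} {j} (step eq e) q
    rewrite doneF-suc f q j | doneF-suc (suc f) q j | eq =
      cong ((p j ≤ᵇ q j) ∧_) (doneF-fuel e q)

  anc-parent : ∀ u v → anc u v ≡ does (u ≟ v) ∨ maybe (λ i → anc i v) false (parent u)
  anc-parent u v = trans (inSuccF-fuel (ends u) v) (inSuccF-suc n u v)

  doneQ-revealedQ : ∀ q j → doneQ I q j ≡ (p j ≤ᵇ q j) ∧ revealedQ I q j
  doneQ-revealedQ q j = trans (doneF-fuel (ends j) q)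
    (trans (doneF-suc n q j) (cong ((p j ≤ᵇ q j) ∧_) (sym (revealedQ-parent q j))))

  doneF-mono : ∀ {q q′} → (∀ j → q j ≤ q′ j) → ∀ f j → doneF I f q j ≡ true → doneF I f q′ j ≡ true
  doneF-mono {q} {q′} q≤q′ (suc f) j d =
    trans (doneF-suc f q′ j)
      (cong₂ _∧_ (≤⇒≤ᵇ-true (≤-trans (≤ᵇ-true⇒≤ {p j} {q j} (∧-conicalˡ _ _ d′)) (q≤q′ j)))
                 (at (parent j) (∧-conicalʳ (p j ≤ᵇ q j) _ d′)))
    where
    d′ : (p j ≤ᵇ q j) ∧ maybe (doneF I f q) true (parent j) ≡ true
    d′ = trans (sym (doneF-suc f q j)) d
    at : ∀ m → maybe (doneF I f q) true m ≡ true → maybe (doneF I f q′) true m ≡ true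
    at nothing  _  = refl
    at (just i) di = doneF-mono q≤q′ f i di

  revealedQ-mono : ∀ {q q′} → (∀ j → q j ≤ q′ j) → ∀ j → revealedQ I q j ≡ true → revealedQ I q′ j ≡ true
  revealedQ-mono q≤q′ j r with parent j
  ... | nothing = refl
  ... | just i  = doneF-mono q≤q′ n i r

  -- The state kept by the simulation is compared with `proc` pointwise, so results are carried over
  -- along pointwise equality.
  doneF-cong : ∀ {q q′} → (∀ j → q j ≡ q′ j) → ∀ f j → doneF I f q j ≡ doneF I f q′ j
  doneF-cong q≡q′ zero    j = refl
  doneF-cong {q} {q′} q≡q′ (suc f) j
    rewrite doneF-suc f q j | doneF-suc f q′ j | q≡q′ j with parent j
  ... | nothing = refl
  ... | just i  = cong ((p j ≤ᵇ q′ j) ∧_) (doneF-cong q≡q′ f i)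

  revealedQ-cong : ∀ {q q′} → (∀ j → q j ≡ q′ j) → ∀ j → revealedQ I q j ≡ revealedQ I q′ j
  revealedQ-cong q≡q′ j with parent j
  ... | nothing = refl
  ... | just i  = doneF-cong q≡q′ n i

  doneQ⇒p≤q : ∀ q j → doneQ I q j ≡ true → p j ≤ q j
  doneQ⇒p≤q q j d = ≤ᵇ-true⇒≤ (∧-conicalˡ _ _ (trans (sym (doneQ-revealedQ q j)) d))

  doneQ⇒revealedQ : ∀ q j → doneQ I q j ≡ true → revealedQ I q j ≡ true
  doneQ⇒revealedQ q j d = ∧-conicalʳ _ _ (trans (sym (doneQ-revealedQ q j)) d)

  revealedQ∧p≤q⇒doneQ : ∀ q j → revealedQ I q j ≡ true → p j ≤ q j → doneQ I q j ≡ true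
  revealedQ∧p≤q⇒doneQ q j r p≤q = trans (doneQ-revealedQ q j) (cong₂ _∧_ (≤⇒≤ᵇ-true p≤q) r)

  anc-done : ∀ q j v → doneQ I q j ≡ true → anc j v ≡ true → doneQ I q v ≡ true
  anc-done q j v = go (ends j)
    where
    go : ∀ {f j} → Ends f j → doneQ I q j ≡ true → anc j v ≡ true → doneQ I q v ≡ true
    go {j = j} e d a with j ≟ v | trans (sym (anc-parent j v)) a
    go e          d a | yes refl | _  = d
    go (root eq)  d a | no _     | a′ rewrite eq = ⊥-elim (false≢true a′)
    go {j = j} (step eq e) d a | no _ | a′ rewrite eq =
      go e (trans (sym (trans (revealedQ-parent q j) (cong (maybe (doneQ I q) true) eq)))
              (doneQ⇒revealedQ q j d)) a′

  -- The front and subtree weights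

  front : (Fin n → ℚ) → Fin n → Bool
  front q v = revealedQ I q v ∧ not (doneQ I q v)

  done⇒¬front : ∀ q v → doneQ I q v ≡ true → front q v ≡ false
  done⇒¬front q v d rewrite d = ∧-zeroʳ _

  -- Climb the chain of `j`. If `j` is done, so are its ancestors and no term survives. If `j` is
  -- revealed but unfinished, its proper ancestors are done and only `j` counts. If `j` is hidden,
  -- it contributes nothing and the sum is that of its unfinished parent.
  front-ancestors : ∀ q j → ∑ J (λ v → ⟦ anc j v ⟧ * ⟦ front q v ⟧) ≡ ⟦ not (doneQ I q j) ⟧
  front-ancestors q j = go (ends j)
    where
    parent-done : ∀ {j i} → parent j ≡ just i → revealedQ I q j ≡ doneQ I q i
    parent-done {j} eq = trans (revealedQ-parent q j) (cong (maybe (doneQ I q) true) eq)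

    done-term : ∀ j v → doneQ I q j ≡ true → ⟦ anc j v ⟧ * ⟦ front q v ⟧ ≡ 0ℚ
    done-term j v d with anc j v in eq
    ... | false = *-zeroˡ ⟦ front q v ⟧
    ... | true  rewrite done⇒¬front q v (anc-done q j v d eq) = *-zeroʳ 1ℚ

    front-term : ∀ j v → revealedQ I q j ≡ true → doneQ I q j ≡ false →
                 ⟦ anc j v ⟧ * ⟦ front q v ⟧ ≡ ⟦ does (j ≟ v) ⟧ * 1ℚ
    front-term j v r d with anc-parent j v
    ... | eq with j ≟ v
    ... | yes refl rewrite eq | r | d = refl
    ... | no _ = trans (cong (λ b → ⟦ b ⟧ * ⟦ front q v ⟧) eq) (trans (above (parent j) refl) (sym (*-zeroˡ 1ℚ)))
      where
      above : ∀ m → parent j ≡ m → ⟦ maybe (λ i → anc i v) false m ⟧ * ⟦ front q v ⟧ ≡ 0ℚ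
      above nothing  _   = *-zeroˡ ⟦ front q v ⟧
      above (just i) par = done-term i v (trans (sym (parent-done par)) r)

    hidden-term : ∀ j i v → parent j ≡ just i → revealedQ I q j ≡ false →
                  ⟦ anc j v ⟧ * ⟦ front q v ⟧ ≡ ⟦ anc i v ⟧ * ⟦ front q v ⟧
    hidden-term j i v par r with anc-parent j v
    ... | eq with j ≟ v
    ... | yes refl rewrite r = trans (*-zeroʳ ⟦ anc j j ⟧) (sym (*-zeroʳ ⟦ anc i j ⟧))
    ... | no _ rewrite par = cong (λ b → ⟦ b ⟧ * ⟦ front q v ⟧) eq

    go : ∀ {f j} → Ends f j → ∑ J (λ v → ⟦ anc j v ⟧ * ⟦ front q v ⟧) ≡ ⟦ not (doneQ I q j) ⟧
    go {j = j} e with doneQ I q j in d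
    ... | true = trans (∑-cong J (λ v → done-term j v d)) (∑-zero J)
    ... | false with revealedQ I q j in r
    ...   | true = trans (∑-cong J (λ v → front-term j v r d)) (∑-δ j (λ _ → 1ℚ))
    go {j = j} (root eq) | false | false =
      ⊥-elim (false≢true (trans (sym r) (trans (revealedQ-parent q j) (cong (maybe (doneQ I q) true) eq))))
    go {j = j} (step {i = i} eq e) | false | false =
      trans (∑-cong J (λ v → hidden-term j i v eq r))
        (trans (go e) (cong (λ b → ⟦ not b ⟧) (trans (sym (parent-done eq)) r)))

  ω : Fin n → ℚ
  ω = wS I

  ω-∑ : ∀ v → ω v ≡ ∑ J (λ u → w u * ⟦ anc u v ⟧)
  ω-∑ v = trans (foldr≡∑ J _) (∑-cong J eq)
    where
    eq : ∀ u → (if anc u v then w u else 0ℚ) ≡ w u * ⟦ anc u v ⟧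
    eq u with anc u v
    ... | true  = sym (*-identityʳ (w u))
    ... | false = sym (*-zeroʳ (w u))

  ω-nonneg : ∀ v → 0ℚ ≤ ω v
  ω-nonneg v = subst (0ℚ ≤_) (sym (ω-∑ v)) (∑-nonneg J λ u → *-nonneg (w≥0 u) (⟦⟧-nonneg (anc u v)))

  -- Double counting: `g v` is counted once for each job `j` in the subtree of `v`, and the weights
  -- of these jobs add up to `ω v`.
  ∑-ancestors : ∀ (g : Fin n → ℚ) →
    ∑ J (λ j → w j * ∑ J (λ v → ⟦ anc j v ⟧ * g v)) ≡ ∑ J (λ v → ω v * g v)
  ∑-ancestors g = begin
    ∑ J (λ j → w j * ∑ J (λ v → ⟦ anc j v ⟧ * g v))
      ≡⟨ ∑-cong J (λ j → trans (∑-*ˡ J (w j) _) (∑-cong J λ v → sym (*-assoc (w j) ⟦ anc j v ⟧ (g v)))) ⟩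
    ∑ J (λ j → ∑ J (λ v → w j * ⟦ anc j v ⟧ * g v))
      ≡⟨ ∑-swap J J _ ⟩
    ∑ J (λ v → ∑ J (λ j → w j * ⟦ anc j v ⟧ * g v))
      ≡⟨ ∑-cong J (λ v → trans (sym (∑-*ʳ J (g v) _)) (cong (_* g v) (sym (ω-∑ v)))) ⟩
    ∑ J (λ v → ω v * g v) ∎
    where open ≡-Reasoning

  -- The completion time if every front job v ran at rate ω v, i.e. in the clock that
  -- advances by 1 / W(s) during step s of the algorithm.
  virtualTime : Fin n → ℚ
  virtualTime i = ∑ J (λ v → ⟦ anc i v ⟧ * (p v * inv (ω v)))

  -- A job of length zero is done as soon as it is revealed and may need no time step of its own, so
  -- it must not count towards the depth of a chain.
  positive-length : Fin n → ℚ
  positive-length v = ⟦ not (p v ≤ᵇ 0ℚ) ⟧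

  -- Schedules and lower bounds on the optimum

  module Schedule (R : ℕ → Fin n → ℚ) (R≥0 : ∀ t j → 0ℚ ≤ R t j) where

    proc-mono : ∀ {s t} → s ℕ.≤ t → ∀ j → proc I R s j ≤ proc I R t j
    proc-mono {t = t} s≤t j = go (ℕₚ.≤⇒≤′ s≤t)
      where
      go : ∀ {s t} → s ℕ.≤′ t → proc I R s j ≤ proc I R t j
      go (ℕ.≤′-reflexive refl)    = ≤-refl
      go {t = suc t} (ℕ.≤′-step s≤t) = ≤-trans (go s≤t) (a≤a+b (R≥0 t j))

    proc-nonneg : ∀ t j → 0ℚ ≤ proc I R t j
    proc-nonneg t = proc-mono {0} {t} ℕ.z≤n

    done-mono : ∀ {s t} → s ℕ.≤ t → ∀ j → done I R s j ≡ true → done I R t j ≡ true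
    done-mono s≤t = doneF-mono (proc-mono s≤t) n

    proc-total : ∀ T → ∑ J (proc I R T) ≡ ∑ (downFrom T) (λ t → ∑ J (R t))
    proc-total zero    = ∑-zero J
    proc-total (suc T) = trans (∑-+ J (proc I R T) (R T))
      (trans (+-comm _ (∑ J (R T))) (cong (_+_ (∑ J (R T))) (proc-total T)))

  module LowerBound (R : ℕ → Fin n → ℚ) (C : Fin n → ℕ)
                    (feasible : Feasible I R) (completion : IsCompletion I R C) where

    open Schedule R (proj₁ feasible)

    opt : ℚ
    opt = ∑ J (λ j → w j * ℕ→ℚ (C j))

    C-parent-≤ : ∀ {i j} → parent j ≡ just i → C i ℕ.≤ C j
    C-parent-≤ {i} {j} par = ℕₚ.≮⇒≥ λ Cj<Ci →
      false≢true (trans (sym (proj₂ (completion i) (C j) Cj<Ci)) i-done)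
      where
      i-done : done I R (C j) i ≡ true
      i-done = trans (sym (trans (revealedQ-parent _ j) (cong (maybe (doneQ I _) true) par)))
                 (doneQ⇒revealedQ _ j (proj₁ (completion j)))

    -- The rate `R t j` is governed by the state after `t` steps, and the parent is done in that
    -- state only from `t = C i` on. So nothing has been processed even at `t = C i`, which makes
    -- `C-parent-<` strict.
    untouched : ∀ {i j} → parent j ≡ just i → ∀ t → t ℕ.≤ C i → proc I R t j ≡ 0ℚ
    untouched         par zero    _    = refl
    untouched {i} {j} par (suc t) t<Ci = cong₂ _+_ (untouched par t (ℕₚ.<⇒≤ t<Ci))
      (≤-antisym (ℚₚ.≮⇒≥ λ 0<R → false≢true (trans (sym hidden) (proj₂ (proj₂ feasible) t j 0<R)))
                 (proj₁ feasible t j))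
      where
      hidden : revealed I R t j ≡ false
      hidden = trans (revealedQ-parent _ j)
        (trans (cong (maybe (doneQ I _) true) par) (proj₂ (completion i) t t<Ci))

    C-parent-< : ∀ {i j} → parent j ≡ just i → (p j ≤ᵇ 0ℚ) ≡ false → C i ℕ.< C j
    C-parent-< {i} {j} par pos = ℕₚ.≰⇒> λ Cj≤Ci →
      <-irrefl refl (<-≤-trans (≤ᵇ-false⇒> pos)
        (subst (p j ≤_) (untouched par (C j) Cj≤Ci) (doneQ⇒p≤q _ j (proj₁ (completion j)))))

    C-root : ∀ j → (p j ≤ᵇ 0ℚ) ≡ false → 0 ℕ.< C j
    C-root j pos = ℕₚ.≰⇒> λ Cj≤0 →
      <-irrefl refl (<-≤-trans (≤ᵇ-false⇒> pos)
        (≤-trans (doneQ⇒p≤q _ j (proj₁ (completion j))) (proc-mono Cj≤0 j)))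

    -- A job of positive length is revealed only after its parent is done, so it needs a
    -- time step of its own.
    depth-bound : ∀ j → ∑ J (λ v → ⟦ anc j v ⟧ * positive-length v) ≤ ℕ→ℚ (C j)
    depth-bound j = go (ends j)
      where
      x = positive-length

      root-term : ∀ {j} → parent j ≡ nothing → ∀ v → ⟦ anc j v ⟧ * x v ≡ ⟦ does (j ≟ v) ⟧ * x v
      root-term {j} par v with anc-parent j v
      ... | eq rewrite par with does (j ≟ v)
      ...   | true  = cong (λ b → ⟦ b ⟧ * x v) eq
      ...   | false = cong (λ b → ⟦ b ⟧ * x v) eq

      step-term : ∀ {i j} → parent j ≡ just i → ∀ v →
                  ⟦ anc j v ⟧ * x v ≤ ⟦ does (j ≟ v) ⟧ * x v + ⟦ anc i v ⟧ * x v
      step-term {i} {j} par v with anc-parent j v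
      ... | eq rewrite par with does (j ≟ v)
      ...   | true  rewrite eq = a≤a+b (⟦⟧*-nonneg (anc i v) (⟦⟧-nonneg (not (p v ≤ᵇ 0ℚ))))
      ...   | false rewrite eq = b≤a+b (⟦⟧*-nonneg false (⟦⟧-nonneg (not (p v ≤ᵇ 0ℚ))))

      root-step : ∀ j → x j ≤ ℕ→ℚ (C j)
      root-step j with p j ≤ᵇ 0ℚ in eq
      ... | true  = ℕ→ℚ-nonneg (C j)
      ... | false = ℕ→ℚ-mono (C-root j eq)

      child-step : ∀ {i j} → parent j ≡ just i → x j + ℕ→ℚ (C i) ≤ ℕ→ℚ (C j)
      child-step {i} {j} par with p j ≤ᵇ 0ℚ in eq
      ... | true  = subst (_≤ ℕ→ℚ (C j)) (sym (+-identityˡ _)) (ℕ→ℚ-mono (C-parent-≤ par))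
      ... | false = subst (_≤ ℕ→ℚ (C j)) (ℕ→ℚ-suc (C i)) (ℕ→ℚ-mono (C-parent-< par eq))

      go : ∀ {f j} → Ends f j → ∑ J (λ v → ⟦ anc j v ⟧ * x v) ≤ ℕ→ℚ (C j)
      go {j = j} (root par) =
        ≤-trans (≤-reflexive (trans (∑-cong J (root-term par)) (∑-δ j x))) (root-step j)
      go {j = j} (step {i = i} par e) = begin
        ∑ J (λ v → ⟦ anc j v ⟧ * x v)
          ≤⟨ ∑-mono J (step-term par) ⟩
        ∑ J (λ v → ⟦ does (j ≟ v) ⟧ * x v + ⟦ anc i v ⟧ * x v)
          ≡⟨ ∑-+ J _ _ ⟩
        ∑ J (λ v → ⟦ does (j ≟ v) ⟧ * x v) + ∑ J (λ v → ⟦ anc i v ⟧ * x v)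
          ≤⟨ +-mono-≤ (≤-reflexive (∑-δ j x)) (go e) ⟩
        x j + ℕ→ℚ (C i)
          ≤⟨ child-step par ⟩
        ℕ→ℚ (C j) ∎
        where open ≤-Reasoning

    ∑-positive-length : ∑ J (λ v → ω v * positive-length v) ≤ opt
    ∑-positive-length = ≤-trans (≤-reflexive (sym (∑-ancestors positive-length)))
      (∑-mono J λ j → *-monoˡ (w≥0 j) (depth-bound j))

    -- This is `H_i(t)`: how far `R` has advanced the chain of `i`, measured in the clock of
    -- `virtualTime`.
    progress : Fin n → ℕ → ℚ
    progress i t = ∑ J (λ v → ⟦ anc i v ⟧ * (proc I R t v * inv (ω v)))

    progress-nonneg : ∀ i t → 0ℚ ≤ progress i t
    progress-nonneg i t = ∑-nonneg J λ v →
      ⟦⟧*-nonneg (anc i v) (*-nonneg (proc-nonneg t v) (inv-nonneg (ω-nonneg v)))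

    virtualTime≤progress : ∀ i {t} → C i ℕ.≤ t → virtualTime i ≤ progress i t
    virtualTime≤progress i {t} Ci≤t = ∑-mono J term
      where
      term : ∀ v → ⟦ anc i v ⟧ * (p v * inv (ω v)) ≤ ⟦ anc i v ⟧ * (proc I R t v * inv (ω v))
      term v with anc i v in eq
      ... | false = ≤-reflexive (trans (*-zeroˡ (p v * inv (ω v))) (sym (*-zeroˡ (proc I R t v * inv (ω v)))))
      ... | true  = *-monoˡ 0≤1 (*-monoʳ (inv-nonneg (ω-nonneg v))
        (≤-trans (doneQ⇒p≤q _ v (anc-done _ i v (proj₁ (completion i)) eq)) (proc-mono Ci≤t v)))

    -- Grouped by `v`, the factor `ω v` cancels `inv (ω v)`. What remains is the total work, at most
    -- one unit per step.
    ∑-progress : ∀ t → ∑ J (λ i → w i * progress i t) ≤ ℕ→ℚ t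
    ∑-progress t = begin
      ∑ J (λ i → w i * progress i t)
        ≡⟨ ∑-ancestors (λ v → proc I R t v * inv (ω v)) ⟩
      ∑ J (λ v → ω v * (proc I R t v * inv (ω v)))
        ≤⟨ ∑-mono J term ⟩
      ∑ J (proc I R t)
        ≡⟨ proc-total t ⟩
      ∑ (downFrom t) (λ s → ∑ J (R s))
        ≤⟨ slots t ⟩
      ℕ→ℚ t ∎
      where
      open ≤-Reasoning
      -- Only an inequality, since the left side vanishes when `ω v` is zero.
      term : ∀ v → ω v * (proc I R t v * inv (ω v)) ≤ proc I R t v
      term v = subst₂ _≤_
        (solve 3 (λ a b c → b :* (a :* c) := a :* (b :* c)) refl (ω v) (proc I R t v) (inv (ω v)))
        (*-identityʳ (proc I R t v)) (*-monoˡ (proc-nonneg t v) (*-inv≤1 (ω v)))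
      slots : ∀ t → ∑ (downFrom t) (λ s → ∑ J (R s)) ≤ ℕ→ℚ t
      slots zero    = ≤-refl
      slots (suc t) = subst (∑ (downFrom (suc t)) (λ s → ∑ J (R s)) ≤_) (sym (ℕ→ℚ-suc t))
        (+-mono-≤ (subst (_≤ 1ℚ) (foldr≡∑ J (R t)) (proj₁ (proj₂ feasible) t)) (slots t))

    -- When the later of i and j completes, the whole chain of the earlier one has been processed.
    pair-bound : ∀ {m} i j → m ≤ virtualTime i → m ≤ virtualTime j →
                 m ≤ progress i (C j) + progress j (C i)
    pair-bound i j m≤Vi m≤Vj with ℕₚ.≤-total (C i) (C j)
    ... | inj₁ Ci≤Cj = ≤-trans m≤Vi (≤-trans (virtualTime≤progress i Ci≤Cj) (a≤a+b (progress-nonneg j (C i))))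
    ... | inj₂ Cj≤Ci = ≤-trans m≤Vj (≤-trans (virtualTime≤progress j Cj≤Ci) (b≤a+b (progress-nonneg i (C j))))

    pairs-bound : ∀ (m : Fin n → Fin n → ℚ) →
      (∀ i j → m i j ≤ virtualTime i) → (∀ i j → m i j ≤ virtualTime j) →
      ∑ J (λ i → w i * ∑ J (λ j → w j * m i j)) ≤ opt + opt
    pairs-bound m m≤Vi m≤Vj = begin
      ∑ J (λ i → w i * ∑ J (λ j → w j * m i j))
        ≤⟨ ∑-mono J (λ i → *-monoˡ (w≥0 i) (∑-mono J λ j →
             *-monoˡ (w≥0 j) (pair-bound i j (m≤Vi i j) (m≤Vj i j)))) ⟩
      ∑ J (λ i → w i * ∑ J (λ j → w j * (progress i (C j) + progress j (C i))))
        ≡⟨ ∑-cong J (λ i → trans (cong (_*_ (w i)) (trans (∑-cong J λ j → *-distribˡ-+ (w j) (progress i (C j)) (progress j (C i))) (∑-+ J _ _)))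
             (*-distribˡ-+ (w i) (∑ J (λ j → w j * progress i (C j))) (∑ J (λ j → w j * progress j (C i))))) ⟩
      ∑ J (λ i → w i * ∑ J (λ j → w j * progress i (C j)) + w i * ∑ J (λ j → w j * progress j (C i)))
        ≡⟨ ∑-+ J _ _ ⟩
      ∑ J (λ i → w i * ∑ J (λ j → w j * progress i (C j))) + ∑ J (λ i → w i * ∑ J (λ j → w j * progress j (C i)))
        -- After the exchange the first double sum is the second with `i` and `j` renamed, so one
        -- `bound` serves both.
        ≡⟨ cong (_+ ∑ J (λ i → w i * ∑ J (λ j → w j * progress j (C i)))) exchange ⟩
      ∑ J (λ j → w j * ∑ J (λ i → w i * progress i (C j))) + ∑ J (λ i → w i * ∑ J (λ j → w j * progress j (C i)))
        ≤⟨ +-mono-≤ bound bound ⟩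
      opt + opt ∎
      where
      open ≤-Reasoning
      bound : ∑ J (λ j → w j * ∑ J (λ i → w i * progress i (C j))) ≤ opt
      bound = ∑-mono J λ j → *-monoˡ (w≥0 j) (∑-progress (C j))
      exchange : ∑ J (λ i → w i * ∑ J (λ j → w j * progress i (C j)))
               ≡ ∑ J (λ j → w j * ∑ J (λ i → w i * progress i (C j)))
      exchange = trans (∑-cong J (λ i → ∑-*ˡ J (w i) _)) (trans (∑-swap J J _)
        (∑-cong J λ j → trans (∑-cong J λ i →
          solve 3 (λ a b c → a :* (b :* c) := b :* (a :* c)) refl (w i) (w j) (progress i (C j)))
          (sym (∑-*ˡ J (w j) _))))

  -- Proportional allocation

  frontWeight : (Fin n → ℚ) → ℚ
  frontWeight q = ∑ J (λ v → ω v * ⟦ front q v ⟧)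

  frontWeight-nonneg : ∀ q → 0ℚ ≤ frontWeight q
  frontWeight-nonneg q = ∑-nonneg J λ v → *-nonneg (ω-nonneg v) (⟦⟧-nonneg (front q v))

  -- A front of weight zero means that all unfinished jobs have weight zero. They add nothing to the
  -- cost but must still complete, so each front job then gets a unit share.
  share : (Fin n → ℚ) → Fin n → ℚ
  share q v = if frontWeight q ≤ᵇ 0ℚ then 1ℚ else ω v

  alloc : (Fin n → ℚ) → Fin n → ℚ
  alloc q v = ⟦ front q v ⟧ * share q v

  share-nonneg : ∀ q v → 0ℚ ≤ share q v
  share-nonneg q v with frontWeight q ≤ᵇ 0ℚ
  ... | true  = 0≤1
  ... | false = ω-nonneg v

  alloc-nonneg : ∀ q v → 0ℚ ≤ alloc q v
  alloc-nonneg q v = ⟦⟧*-nonneg (front q v) (share-nonneg q v)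

  share-positive : ∀ q v → (frontWeight q ≤ᵇ 0ℚ) ≡ false → share q v ≡ ω v
  share-positive q v pos = cong (if_then 1ℚ else ω v) pos

  ∑-alloc-positive : ∀ q → (frontWeight q ≤ᵇ 0ℚ) ≡ false → ∑ J (alloc q) ≡ frontWeight q
  ∑-alloc-positive q pos = ∑-cong J λ v →
    trans (cong (⟦ front q v ⟧ *_) (share-positive q v pos)) (*-comm ⟦ front q v ⟧ (ω v))

  -- If the front has positive weight, the sum equals that weight. Otherwise every front job has
  -- share `1`, and `front-ancestors` supplies one on the chain of `j`.
  unfinished⇒∑-alloc>0 : ∀ q j → doneQ I q j ≡ false → 0ℚ < ∑ J (alloc q)
  unfinished⇒∑-alloc>0 q j unfinished = go (frontWeight q ≤ᵇ 0ℚ) refl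
    where
    go : ∀ b → (frontWeight q ≤ᵇ 0ℚ) ≡ b → 0ℚ < ∑ J (alloc q)
    go false eq = subst (0ℚ <_) (sym (∑-alloc-positive q eq)) (≤ᵇ-false⇒> {frontWeight q} {0ℚ} eq)
    go true  eq = <-≤-trans 0<1 (subst (_≤ ∑ J (alloc q))
        (trans (front-ancestors q j) (cong (λ b → ⟦ not b ⟧) unfinished)) (∑-mono J term))
      where
      term : ∀ v → ⟦ anc j v ⟧ * ⟦ front q v ⟧ ≤ alloc q v
      term v = ≤-trans (⟦⟧*-≤ (anc j v) (⟦⟧-nonneg (front q v)))
        (≤-reflexive (sym (trans (cong (λ b → ⟦ front q v ⟧ * (if b then 1ℚ else ω v)) eq)
                                 (*-identityʳ ⟦ front q v ⟧))))

  front⇒p>q : ∀ q v → front q v ≡ true → q v < p v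
  front⇒p>q q v fr = ≰⇒> λ p≤q →
    false≢true (trans (sym (done⇒¬front q v (revealedQ∧p≤q⇒doneQ q v (∧-conicalˡ _ _ fr) p≤q))) fr)

  -- Feasibility and termination of proportional rates

  module Proportional (R : ℕ → Fin n → ℚ)
    (rate : ∀ t v → R t v ≡ alloc (proc I R t) v * inv (∑ J (alloc (proc I R t)))) where

    R≥0 : ∀ t v → 0ℚ ≤ R t v
    R≥0 t v = subst (0ℚ ≤_) (sym (rate t v))
      (*-nonneg (alloc-nonneg _ v) (inv-nonneg (∑-nonneg J (alloc-nonneg _))))

    open Schedule R R≥0

    ∑-rates : ∀ t → ∑ J (R t) ≡ ∑ J (alloc (proc I R t)) * inv (∑ J (alloc (proc I R t)))
    ∑-rates t = trans (∑-cong J (rate t)) (sym (∑-*ʳ J _ _))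

    ∑-rates≤1 : ∀ t → ∑ J (R t) ≤ 1ℚ
    ∑-rates≤1 t = subst (_≤ 1ℚ) (sym (∑-rates t)) (*-inv≤1 (∑ J (alloc (proc I R t))))

    idle : ∀ t v → front (proc I R t) v ≡ false → R t v ≡ 0ℚ
    idle t v ¬fr = trans (rate t v) (trans
      (cong (_* inv (∑ J (alloc (proc I R t)))) (trans (cong (λ b → ⟦ b ⟧ * share (proc I R t) v) ¬fr) (*-zeroˡ (share (proc I R t) v))))
      (*-zeroˡ (inv (∑ J (alloc (proc I R t))))))

    processed⇒front : ∀ t v → 0ℚ < R t v → front (proc I R t) v ≡ true
    processed⇒front t v 0<R with front (proc I R t) v in eq
    ... | true  = refl
    ... | false = ⊥-elim (<-irrefl (sym (idle t v eq)) 0<R)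

    feasible : Feasible I R
    feasible = R≥0 , (λ t → subst (_≤ 1ℚ) (sym (foldr≡∑ J (R t))) (∑-rates≤1 t)) ,
      λ t v 0<R → ∧-conicalˡ _ _ (processed⇒front t v 0<R)

    -- A job is served only while it has received less than `p v`, so any excess stems from a single
    -- step, whose total rate is at most `1`.
    proc≤p+1 : ∀ t v → proc I R t v ≤ p v + 1ℚ
    proc≤p+1 zero    v = +-nonneg (p≥0 v) 0≤1
    proc≤p+1 (suc t) v with front (proc I R t) v in eq
    ... | false = subst (_≤ p v + 1ℚ) (sym (trans (cong (_+_ (proc I R t v)) (idle t v eq)) (+-identityʳ _))) (proc≤p+1 t v)
    ... | true  = +-mono-≤ (<⇒≤ (front⇒p>q (proc I R t) v eq)) (≤-trans (term≤∑ v (R≥0 t)) (∑-rates≤1 t))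

    horizon : ℕ
    horizon = proj₁ (archimedean (∑ J (λ v → p v + 1ℚ)))

    -- While some job is unfinished the machine is fully used, but no job receives more than p v + 1.
    all-done : ∀ j → done I R horizon j ≡ true
    all-done j with done I R horizon j in eq
    ... | true  = refl
    ... | false = ⊥-elim (<-irrefl refl (<-≤-trans (proj₂ (archimedean (∑ J (λ v → p v + 1ℚ))))
        (subst (_≤ ∑ J (λ v → p v + 1ℚ)) (trans (proc-total horizon) (busy horizon ℕₚ.≤-refl)) (∑-mono J (proc≤p+1 horizon)))))
      where
      unfinished : ∀ t → t ℕ.≤ horizon → done I R t j ≡ false
      unfinished t t≤T with done I R t j in d
      ... | false = refl
      ... | true  = trans (sym (done-mono t≤T j d)) eq
      busy : ∀ T → T ℕ.≤ horizon → ∑ (downFrom T) (λ t → ∑ J (R t)) ≡ ℕ→ℚ T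
      busy zero    _   = refl
      busy (suc T) T<h = trans (cong₂ _+_
        (trans (∑-rates T) (inv-inverse λ ≡0 → <-irrefl (sym ≡0)
          (unfinished⇒∑-alloc>0 (proc I R T) j (unfinished T (ℕₚ.<⇒≤ T<h)))))
        (busy T (ℕₚ.<⇒≤ T<h))) (sym (ℕ→ℚ-suc T))

    C : Fin n → ℕ
    C j = falses (λ t → done I R t j) horizon

    completion : IsCompletion I R C
    completion j = true-at-falses mono horizon (all-done j) , false-below-falses mono horizon
      where
      mono : ∀ {s t} → s ℕ.≤ t → done I R s j ≡ true → done I R t j ≡ true
      mono s≤t = done-mono s≤t j

    -- Cost of proportional rates

    steps : List ℕ
    steps = downFrom horizon

    W : ℕ → ℚ
    W s = frontWeight (proc I R s)

    -- A completion time counts the steps that start with the job unfinished. Within each step,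
    -- `front-ancestors` then moves the weight of every unfinished job to its unique front ancestor.
    cost-∑-W : ∑ J (λ j → w j * ℕ→ℚ (C j)) ≡ ∑ steps W
    cost-∑-W = begin
      ∑ J (λ j → w j * ℕ→ℚ (C j))
        ≡⟨ ∑-cong J (λ j → cong (_*_ (w j)) (ℕ→ℚ-falses (λ t → done I R t j) horizon)) ⟩
      ∑ J (λ j → w j * ∑ steps (λ s → ⟦ not (done I R s j) ⟧))
        ≡⟨ ∑-cong J (λ j → ∑-*ˡ steps (w j) _) ⟩
      ∑ J (λ j → ∑ steps (λ s → w j * ⟦ not (done I R s j) ⟧))
        ≡⟨ ∑-swap J steps _ ⟩
      ∑ steps (λ s → ∑ J (λ j → w j * ⟦ not (done I R s j) ⟧))
        ≡⟨ ∑-cong steps (λ s → trans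
             (∑-cong J λ j → cong (_*_ (w j)) (sym (front-ancestors (proc I R s) j)))
             (∑-ancestors (λ v → ⟦ front (proc I R s) v ⟧))) ⟩
      ∑ steps W ∎
      where open ≡-Reasoning

    -- In a last step most of the rate may be wasted; full steps are those in which everything
    -- allocated to v is work that v needs.  Requiring ω v > 0 avoids the junk value inv 0ℚ.
    last full : ℕ → Fin n → Bool
    last s v = front (proc I R s) v ∧ done I R (suc s) v
    full s v = front (proc I R s) v ∧ (not (done I R (suc s) v) ∧ not (ω v ≤ᵇ 0ℚ))

    lastWeight fullWeight : ℕ → ℚ
    lastWeight s = ∑ J (λ v → ω v * ⟦ last s v ⟧)
    fullWeight s = ∑ J (λ v → ω v * ⟦ full s v ⟧)

    W-split : ∀ s → W s ≡ fullWeight s + lastWeight s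
    W-split s = trans (∑-cong J term) (∑-+ J _ _)
      where
      term : ∀ v → ω v * ⟦ front (proc I R s) v ⟧ ≡ ω v * ⟦ full s v ⟧ + ω v * ⟦ last s v ⟧
      term v with front (proc I R s) v | done I R (suc s) v | ω v ≤ᵇ 0ℚ in eq
      ... | false | _     | _     = trans (*-zeroʳ (ω v)) (sym (cong₂ _+_ (*-zeroʳ (ω v)) (*-zeroʳ (ω v))))
      ... | true  | true  | _     = sym (trans (cong (_+ ω v * 1ℚ) (*-zeroʳ (ω v))) (+-identityˡ _))
      ... | true  | false | false = sym (trans (cong (_+_ (ω v * 1ℚ)) (*-zeroʳ (ω v))) (+-identityʳ _))
      -- Such a step is neither last nor full, but `ω v` is zero, so nothing is lost.
      ... | true  | false | true  = trans (cong (_* 1ℚ) ω≡0) (sym (cong₂ _+_ (*-zeroʳ (ω v)) (*-zeroʳ (ω v))))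
        where
        ω≡0 : ω v ≡ 0ℚ
        ω≡0 = ≤-antisym (≤ᵇ-true⇒≤ {ω v} {0ℚ} eq) (ω-nonneg v)

    -- The right side is the inductive invariant behind "at most once": a last step takes `done`
    -- from false to true, and `done` never reverts.
    last-once : ∀ v t → ∑ (downFrom t) (λ s → ⟦ last s v ⟧) ≤ ⟦ done I R t v ⟧
    last-once v zero    = ⟦⟧-nonneg (done I R 0 v)
    last-once v (suc t) = ≤-trans (+-monoʳ-≤ ⟦ last t v ⟧ (last-once v t))
      (combine (revealed I R t v) (done I R t v) (done I R (suc t) v) (done-mono (ℕₚ.n≤1+n t) v))
      where
      combine : ∀ r d d′ → (d ≡ true → d′ ≡ true) → ⟦ (r ∧ not d) ∧ d′ ⟧ + ⟦ d ⟧ ≤ ⟦ d′ ⟧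
      combine r     true  d′ d⇒d′ rewrite d⇒d′ refl | ∧-zeroʳ r = ≤-refl
      combine true  false d′ _ = ≤-reflexive (+-identityʳ ⟦ d′ ⟧)
      combine false false d′ _ = ⟦⟧-nonneg d′

    last-count : ∀ v → ∑ steps (λ s → ⟦ last s v ⟧) ≤ positive-length v
    last-count v with p v ≤ᵇ 0ℚ in eq
    ... | false = ≤-trans (last-once v horizon) (⟦⟧≤1 (done I R horizon v))
    ... | true  = ≤-reflexive (trans (∑-cong steps λ s → cong (λ b → ⟦ b ∧ done I R (suc s) v ⟧) (never s)) (∑-zero steps))
      where
      never : ∀ s → front (proc I R s) v ≡ false
      never s with front (proc I R s) v in fr
      ... | false = refl
      ... | true  = ⊥-elim (<-irrefl refl (<-≤-trans (front⇒p>q (proc I R s) v fr)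
                      (≤-trans (≤ᵇ-true⇒≤ {p v} {0ℚ} eq) (proc-nonneg s v))))

    ∑-lastWeight : ∑ steps lastWeight ≤ ∑ J (λ v → ω v * positive-length v)
    ∑-lastWeight = ≤-trans
      (≤-reflexive (trans (∑-swap steps J _) (∑-cong J λ v → sym (∑-*ˡ steps (ω v) _))))
      (∑-mono J λ v → *-monoˡ (ω-nonneg v) (last-count v))

    -- The second bound uses the first. After a full step `v` is still unfinished, so all it has
    -- received, and hence the sum, is below `p v`; any other step leaves the sum unchanged.
    full-work : ∀ v t → ∑ (downFrom t) (λ s → ⟦ full s v ⟧ * R s v) ≤ proc I R t v
                      × ∑ (downFrom t) (λ s → ⟦ full s v ⟧ * R s v) ≤ p v
    full-work v zero    = ≤-refl , p≥0 v
    full-work v (suc t) = ≤proc , ≤p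
      where
      Σ≤ = full-work v t
      ≤proc : ∑ (downFrom (suc t)) (λ s → ⟦ full s v ⟧ * R s v) ≤ proc I R (suc t) v
      ≤proc = ≤-trans (≤-reflexive (+-comm (⟦ full t v ⟧ * R t v) _))
        (+-mono-≤ (proj₁ Σ≤) (⟦⟧*-≤ (full t v) (R≥0 t v)))
      full⇒proc<p : full t v ≡ true → proc I R (suc t) v < p v
      full⇒proc<p fu = front⇒p>q (proc I R (suc t)) v (cong₂ _∧_
        (revealedQ-mono (proc-mono (ℕₚ.n≤1+n t)) v
          (∧-conicalˡ _ _ (∧-conicalˡ (front (proc I R t) v) _ fu)))
        (∧-conicalˡ (not (done I R (suc t) v)) _ (∧-conicalʳ (front (proc I R t) v) _ fu)))
      ≤p : ∑ (downFrom (suc t)) (λ s → ⟦ full s v ⟧ * R s v) ≤ p v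
      ≤p with full t v in fu | ≤proc
      ... | true  | le = ≤-trans le (<⇒≤ (full⇒proc<p fu))
      ... | false | _  = ≤-trans (≤-reflexive (trans (cong (_+ ∑ (downFrom t) (λ s → ⟦ full s v ⟧ * R s v)) (*-zeroˡ (R t v))) (+-identityˡ _))) (proj₂ Σ≤)

    -- In a full step `v` runs at rate `ω v / W s`, so `inv (W s)` is `R s v / ω v`, and full steps
    -- give `v` at most `p v` of work.
    full-virtual : ∀ v → ∑ steps (λ s → ⟦ full s v ⟧ * inv (W s)) ≤ p v * inv (ω v)
    full-virtual v = ≤-trans (≤-reflexive (trans (∑-cong steps term) (sym (∑-*ʳ steps (inv (ω v)) _))))
      (*-monoʳ (inv-nonneg (ω-nonneg v)) (proj₂ (full-work v horizon)))
      where
      active : ∀ s → full s v ≡ true → inv (W s) ≡ R s v * inv (ω v)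
      active s fu = sym (begin
        R s v * inv (ω v)
          ≡⟨ cong (_* inv (ω v)) (trans (rate s v) (cong₂ _*_
               (trans (cong₂ (λ b x → ⟦ b ⟧ * x) fr (share-positive q v W>0)) (*-identityˡ (ω v)))
               (cong inv (∑-alloc-positive q W>0)))) ⟩
        ω v * inv (W s) * inv (ω v)
          ≡⟨ solve 3 (λ a b c → a :* b :* c := b :* (a :* c)) refl (ω v) (inv (W s)) (inv (ω v)) ⟩
        inv (W s) * (ω v * inv (ω v))
          ≡⟨ cong (inv (W s) *_) (inv-inverse λ ≡0 → <-irrefl (sym ≡0) ω>0) ⟩
        inv (W s) * 1ℚ
          ≡⟨ *-identityʳ _ ⟩
        inv (W s) ∎)
        where
        open ≡-Reasoning
        q = proc I R s
        fr : front q v ≡ true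
        fr = ∧-conicalˡ _ _ fu
        ω>0 : 0ℚ < ω v
        ω>0 = ≤ᵇ-false⇒> {ω v} {0ℚ} (not-injective (∧-conicalʳ (not (done I R (suc s) v)) _ (∧-conicalʳ (front q v) _ fu)))
        ω≤W : ω v ≤ W s
        ω≤W = subst (_≤ W s) (trans (cong (λ b → ω v * ⟦ b ⟧) fr) (*-identityʳ (ω v)))
          (term≤∑ v λ u → *-nonneg (ω-nonneg u) (⟦⟧-nonneg (front q u)))
        -- Positive front weight rules out the unit shares, so the rate is indeed proportional to
        -- `ω v`.
        W>0 : (W s ≤ᵇ 0ℚ) ≡ false
        W>0 with W s ≤ᵇ 0ℚ in eq
        ... | false = refl
        ... | true  = ⊥-elim (<-irrefl refl (<-≤-trans ω>0 (≤-trans ω≤W (≤ᵇ-true⇒≤ {W s} {0ℚ} eq))))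
      term : ∀ s → ⟦ full s v ⟧ * inv (W s) ≡ ⟦ full s v ⟧ * R s v * inv (ω v)
      term s with full s v in fu
      ... | true  = trans (cong (_*_ 1ℚ) (active s fu)) (sym (*-assoc 1ℚ (R s v) (inv (ω v))))
      ... | false = trans (*-zeroˡ (inv (W s)))
                      (sym (trans (cong (_* inv (ω v)) (*-zeroˡ (R s v))) (*-zeroˡ (inv (ω v)))))

    -- At most one ancestor of `i` is in the front, so this is the 0-1 indicator that this ancestor
    -- has a full step at `s`.
    φ : ℕ → Fin n → ℚ
    φ s i = ∑ J (λ v → ⟦ anc i v ⟧ * ⟦ full s v ⟧)

    φ-nonneg : ∀ s i → 0ℚ ≤ φ s i
    φ-nonneg s i = ∑-nonneg J λ v → ⟦⟧*-nonneg (anc i v) (⟦⟧-nonneg (full s v))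

    φ≤1 : ∀ s i → φ s i ≤ 1ℚ
    φ≤1 s i = ≤-trans (∑-mono J λ v → *-monoˡ (⟦⟧-nonneg (anc i v)) (full≤front v))
      (≤-trans (≤-reflexive (front-ancestors (proc I R s) i)) (⟦⟧≤1 (not (done I R s i))))
      where
      full≤front : ∀ v → ⟦ full s v ⟧ ≤ ⟦ front (proc I R s) v ⟧
      full≤front v with front (proc I R s) v
      ... | true  = ⟦⟧≤1 (not (done I R (suc s) v) ∧ not (ω v ≤ᵇ 0ℚ))
      ... | false = ≤-refl

    W⁻¹-nonneg : ∀ s → 0ℚ ≤ inv (W s)
    W⁻¹-nonneg s = inv-nonneg (frontWeight-nonneg (proc I R s))

    chain-virtual : ∀ i → ∑ steps (λ s → φ s i * inv (W s)) ≤ virtualTime i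
    chain-virtual i = ≤-trans (≤-reflexive regroup)
      (∑-mono J λ v → *-monoˡ (⟦⟧-nonneg (anc i v)) (full-virtual v))
      where
      regroup : ∑ steps (λ s → φ s i * inv (W s)) ≡ ∑ J (λ v → ⟦ anc i v ⟧ * ∑ steps (λ s → ⟦ full s v ⟧ * inv (W s)))
      regroup = trans (∑-cong steps λ s → trans (∑-*ʳ J (inv (W s)) _)
                  (∑-cong J λ v → *-assoc ⟦ anc i v ⟧ ⟦ full s v ⟧ (inv (W s))))
        (trans (∑-swap steps J _) (∑-cong J λ v → sym (∑-*ˡ steps ⟦ anc i v ⟧ _)))

    -- The part of the virtual clock in which both chains have full steps. It takes the place of
    -- `min(V_i, V_j)`, being at most both.
    jointTime : Fin n → Fin n → ℚ
    jointTime i j = ∑ steps (λ s → φ s i * φ s j * inv (W s))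

    jointTime≤ˡ : ∀ i j → jointTime i j ≤ virtualTime i
    jointTime≤ˡ i j = ≤-trans (∑-mono steps λ s → *-monoʳ (W⁻¹-nonneg s)
      (subst (φ s i * φ s j ≤_) (*-identityʳ (φ s i)) (*-monoˡ (φ-nonneg s i) (φ≤1 s j)))) (chain-virtual i)

    jointTime≤ʳ : ∀ i j → jointTime i j ≤ virtualTime j
    jointTime≤ʳ i j = subst (_≤ virtualTime j)
      (∑-cong steps λ s → cong (_* inv (W s)) (*-comm (φ s j) (φ s i))) (jointTime≤ˡ j i)

    -- `∑-ancestors` turns `fullWeight s` into the sum of `w i * φ s i` over all `i`. Multiplying
    -- out the square and summing over `s` innermost gives the pairs.
    ∑-fullWeight² : ∑ steps (λ s → fullWeight s * fullWeight s * inv (W s))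
                  ≡ ∑ J (λ i → w i * ∑ J (λ j → w j * jointTime i j))
    ∑-fullWeight² = begin
      ∑ steps (λ s → fullWeight s * fullWeight s * inv (W s))
        ≡⟨ ∑-cong steps expand ⟩
      ∑ steps (λ s → ∑ J (λ i → w i * ∑ J (λ j → w j * (φ s i * φ s j * inv (W s)))))
        ≡⟨ ∑-swap steps J _ ⟩
      ∑ J (λ i → ∑ steps (λ s → w i * ∑ J (λ j → w j * (φ s i * φ s j * inv (W s)))))
        ≡⟨ ∑-cong J (λ i → trans (sym (∑-*ˡ steps (w i) _)) (cong (_*_ (w i))
             (trans (∑-swap steps J _) (∑-cong J λ j → sym (∑-*ˡ steps (w j) _))))) ⟩
      ∑ J (λ i → w i * ∑ J (λ j → w j * jointTime i j)) ∎
      where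
      open ≡-Reasoning
      expand : ∀ s → fullWeight s * fullWeight s * inv (W s)
                   ≡ ∑ J (λ i → w i * ∑ J (λ j → w j * (φ s i * φ s j * inv (W s))))
      expand s = begin
        F * F * y
          ≡⟨ cong (λ f → f * F * y) (sym F≡) ⟩
        ∑ J (λ i → w i * φ s i) * F * y
          ≡⟨ trans (*-assoc (∑ J (λ i → w i * φ s i)) F y) (∑-*ʳ J (F * y) _) ⟩
        ∑ J (λ i → w i * φ s i * (F * y))
          ≡⟨ ∑-cong J (λ i → trans
               (solve 4 (λ a b c d → a :* b :* (c :* d) := a :* (c :* (b :* d))) refl (w i) (φ s i) F y)
               (cong (_*_ (w i)) (trans (cong (_* (φ s i * y)) (sym F≡)) (trans (∑-*ʳ J (φ s i * y) _)
                 (∑-cong J λ j → solve 4 (λ a b c d → a :* b :* (c :* d) := a :* (c :* b :* d)) refl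
                                   (w j) (φ s j) (φ s i) y))))) ⟩
        ∑ J (λ i → w i * ∑ J (λ j → w j * (φ s i * φ s j * y))) ∎
        where
        F = fullWeight s
        y = inv (W s)
        F≡ : ∑ J (λ i → w i * φ s i) ≡ F
        F≡ = ∑-ancestors (λ v → ⟦ full s v ⟧)

    competitive : ∀ R′ C′ → Feasible I R′ → IsCompletion I R′ C′ →
      ∑ J (λ j → w j * ℕ→ℚ (C j)) ≤ ℕ→ℚ 4 * ∑ J (λ j → w j * ℕ→ℚ (C′ j))
    competitive R′ C′ feasible′ completion′ = begin
      ∑ J (λ j → w j * ℕ→ℚ (C j))
        ≡⟨ cost-∑-W ⟩
      ∑ steps W
        ≤⟨ ∑-mono steps (λ s → split-square (fullWeight s) (lastWeight s) (W-split s)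
             (nonneg (full s)) (nonneg (last s))) ⟩
      ∑ steps (λ s → fullWeight s * fullWeight s * inv (W s) + (lastWeight s + lastWeight s))
        ≡⟨ trans (∑-+ steps _ _) (cong₂ _+_ ∑-fullWeight² (∑-+ steps lastWeight lastWeight)) ⟩
      ∑ J (λ i → w i * ∑ J (λ j → w j * jointTime i j)) + (∑ steps lastWeight + ∑ steps lastWeight)
        -- The quadratic part costs two copies of the optimum and the doubled last weights two more,
        -- hence the factor 4.
        ≤⟨ +-mono-≤ (pairs-bound jointTime jointTime≤ˡ jointTime≤ʳ) (+-mono-≤ last≤opt last≤opt) ⟩
      (opt + opt) + (opt + opt)
        ≡⟨ solve 1 (λ a → (a :+ a) :+ (a :+ a) := con (ℕ→ℚ 4) :* a) refl opt ⟩
      ℕ→ℚ 4 * opt ∎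
      where
      open ≤-Reasoning
      open LowerBound R′ C′ feasible′ completion′
      last≤opt : ∑ steps lastWeight ≤ opt
      last≤opt = ≤-trans ∑-lastWeight ∑-positive-length
      nonneg : ∀ (f : Fin n → Bool) → 0ℚ ≤ ∑ J (λ v → ω v * ⟦ f v ⟧)
      nonneg f = ∑-nonneg J λ v → *-nonneg (ω-nonneg v) (⟦⟧-nonneg (f v))

-- The algorithm

open JobView

pendingWeight : List JobView → ℚ
pendingWeight s = ∑ s (λ v → if completed v then 0ℚ else prediction v)

viewAlloc : List JobView → JobView → ℚ
viewAlloc s v = if completed v then 0ℚ else (if pendingWeight s ≤ᵇ 0ℚ then 1ℚ else prediction v)

-- When all predictions of pending jobs are zero these jobs still have to be finished, and
-- they share the machine equally.
proportional : Algorithm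
proportional []      k = 0ℚ
proportional (s ∷ _) k = ∑ s (λ v → if jid v ℕ.≡ᵇ k then viewAlloc s v else 0ℚ) * inv (∑ s (viewAlloc s))

∑-map-filter : ∀ (b : X → Bool) (g : X → Y) (f : Y → ℚ) xs →
  ∑ (map g (filter (λ x → b x Bool.≟ true) xs)) f ≡ ∑ xs (λ x → ⟦ b x ⟧ * f (g x))
∑-map-filter b g f []       = refl
∑-map-filter b g f (x ∷ xs) with b x
... | true  = cong₂ _+_ (sym (*-identityˡ (f (g x)))) (∑-map-filter b g f xs)
... | false = trans (∑-map-filter b g f xs)
  (sym (trans (cong (_+ ∑ xs (λ x → ⟦ b x ⟧ * f (g x))) (*-zeroˡ (f (g x)))) (+-identityˡ _)))

toℕ-≡ᵇ : ∀ {n} (u v : Fin n) → (toℕ v ℕ.≡ᵇ toℕ u) ≡ does (u ≟ v)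
toℕ-≡ᵇ Fin.zero    Fin.zero    = refl
toℕ-≡ᵇ Fin.zero    (Fin.suc v) = refl
toℕ-≡ᵇ (Fin.suc u) Fin.zero    = refl
toℕ-≡ᵇ (Fin.suc u) (Fin.suc v) = toℕ-≡ᵇ u v

-- The simulated run has proportional rates

module Simulation (I : Instance) (pred : Fin (Instance.n I) → ℚ) (correct : ∀ v → pred v ≡ wS I v) where
  open Instance I
  open Forest I

  view : (Fin n → ℚ) → Fin n → JobView
  view q j = jobView (toℕ j) (w j) (pred j) (doneQ I q j)

  snap : (Fin n → ℚ) → List JobView
  snap = snapshot I pred proportional

  ∑-snap : ∀ q f → ∑ (snap q) f ≡ ∑ J (λ j → ⟦ revealedQ I q j ⟧ * f (view q j))
  ∑-snap q f = ∑-map-filter (revealedQ I q) (view q) f J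

  pending-front : ∀ r d x → ⟦ r ⟧ * (if d then 0ℚ else x) ≡ ⟦ r ∧ not d ⟧ * x
  pending-front true  true  x = trans (*-zeroʳ 1ℚ) (sym (*-zeroˡ x))
  pending-front true  false x = refl
  pending-front false d     x = trans (*-zeroˡ (if d then 0ℚ else x)) (sym (*-zeroˡ x))

  pendingWeight-snap : ∀ q → pendingWeight (snap q) ≡ frontWeight q
  pendingWeight-snap q = trans (∑-snap q _) (∑-cong J λ v →
    trans (pending-front (revealedQ I q v) (doneQ I q v) (pred v))
      (trans (cong (⟦ front q v ⟧ *_) (correct v)) (*-comm ⟦ front q v ⟧ (ω v))))

  viewAlloc-snap : ∀ q v → ⟦ revealedQ I q v ⟧ * viewAlloc (snap q) (view q v) ≡ alloc q v
  viewAlloc-snap q v = trans (pending-front (revealedQ I q v) (doneQ I q v) _)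
    (cong (⟦ front q v ⟧ *_) (cong₂ (λ x y → if x ≤ᵇ 0ℚ then 1ℚ else y) (pendingWeight-snap q) (correct v)))

  -- Filtering for revealed jobs becomes an indicator factor, and since identifiers are distinct the
  -- lookup by `jid` picks out `v` alone. Correctness of the predictions turns them into `ω`.
  proportional-snap : ∀ q h v → proportional (snap q ∷ h) (toℕ v) ≡ alloc q v * inv (∑ J (alloc q))
  proportional-snap q h v = cong₂ (λ x y → x * inv y)
    (trans (∑-snap q _) (trans (∑-cong J term) (trans (∑-δ v _) (viewAlloc-snap q v))))
    (trans (∑-snap q _) (∑-cong J (viewAlloc-snap q)))
    where
    term : ∀ u → ⟦ revealedQ I q u ⟧ * (if toℕ u ℕ.≡ᵇ toℕ v then viewAlloc (snap q) (view q u) else 0ℚ)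
               ≡ ⟦ does (v ≟ u) ⟧ * (⟦ revealedQ I q u ⟧ * viewAlloc (snap q) (view q u))
    term u = trans (cong (λ b → ⟦ revealedQ I q u ⟧ * (if b then viewAlloc (snap q) (view q u) else 0ℚ)) (toℕ-≡ᵇ v u))
                   (select (does (v ≟ u)) ⟦ revealedQ I q u ⟧ (viewAlloc (snap q) (view q u)))
      where
      select : ∀ b x y → x * (if b then y else 0ℚ) ≡ ⟦ b ⟧ * (x * y)
      select true  x y = sym (*-identityˡ (x * y))
      select false x y = trans (*-zeroʳ x) (sym (*-zeroˡ (x * y)))

  front-cong : ∀ {q q′} → (∀ j → q j ≡ q′ j) → ∀ v → front q v ≡ front q′ v
  front-cong q≡q′ v = cong₂ (λ r d → r ∧ not d) (revealedQ-cong q≡q′ v) (doneF-cong q≡q′ n v)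

  alloc-cong : ∀ {q q′} → (∀ j → q j ≡ q′ j) → ∀ v → alloc q v ≡ alloc q′ v
  alloc-cong q≡q′ v = cong₂ (λ b x → ⟦ b ⟧ * (if x ≤ᵇ 0ℚ then 1ℚ else ω v)) (front-cong q≡q′ v)
    (∑-cong J λ u → cong (λ b → ω u * ⟦ b ⟧) (front-cong q≡q′ u))

  rates : ℕ → Fin n → ℚ
  rates = algRates I pred proportional

  state : ℕ → Fin n → ℚ
  state t = proj₁ (sim I pred proportional t)

  state-proc : ∀ t j → state t j ≡ proc I rates t j
  state-proc zero    j = refl
  state-proc (suc t) j = cong (_+ rates t j) (state-proc t j)

  -- `proportional` reads only the newest snapshot, so it is enough to identify the head of the
  -- history.
  history-head : ∀ t → Σ (List (List JobView)) λ h → proj₂ (sim I pred proportional t) ≡ snap (state t) ∷ h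
  history-head zero    = [] , refl
  history-head (suc t) = proj₂ (sim I pred proportional t) , refl

  rates-alloc : ∀ t v → rates t v ≡ alloc (proc I rates t) v * inv (∑ J (alloc (proc I rates t)))
  rates-alloc t v = begin
    rates t v                                                 ≡⟨ cong (λ h → proportional h (toℕ v)) (proj₂ (history-head t)) ⟩
    proportional (snap (state t) ∷ proj₁ (history-head t)) (toℕ v)
                                                              ≡⟨ proportional-snap (state t) (proj₁ (history-head t)) v ⟩
    alloc (state t) v * inv (∑ J (alloc (state t)))           ≡⟨ cong₂ (λ x y → x * inv y) (alloc-cong (state-proc t) v)
                                                                   (∑-cong J (alloc-cong (state-proc t))) ⟩
    alloc (proc I rates t) v * inv (∑ J (alloc (proc I rates t))) ∎
    where open ≡-Reasoning

  open Proportional rates rates-alloc public using (feasible; C; completion)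

  cost-bound : ∀ R C′ → Feasible I R → IsCompletion I R C′ → cost I C ≤ ℕ→ℚ 4 * cost I C′
  cost-bound R C′ feasible′ completion′ =
    subst₂ (λ x y → x ≤ ℕ→ℚ 4 * y) (sym (foldr≡∑ J _)) (sym (foldr≡∑ J _))
      (Proportional.competitive rates rates-alloc R C′ feasible′ completion′)

theorem6 : Σ Algorithm λ A →
    (I : Instance) (pred : Fin (Instance.n I) → ℚ) →
    (∀ v → pred v ≡ wS I v) →
    Feasible I (algRates I pred A)
    × Σ (Fin (Instance.n I) → ℕ) λ C →
    IsCompletion I (algRates I pred A) C
    × ((R : ℕ → Fin (Instance.n I) → ℚ) (C′ : Fin (Instance.n I) → ℕ) →
    Feasible I R → IsCompletion I R C′ →
    cost I C ≤ ℕ→ℚ 4 * cost I C′)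
theorem6 = proportional , λ I pred correct →
  let open Simulation I pred correct in feasible , C , completion , cost-bound
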